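{- Let $D_0=\{0,1\}$ and, for $k\ge0$, let $u_k$ be the concatenation of all words of $D_k$ listed in lexicographic order (with $0<1$), and $D_{k+1}=u_kD_k^2=\{u_kw_1w_2: w_1,w_2\in D_k\}$. The sequence $(u_k)_{k\ge0}$ converges to an infinite word $\mathbf{u}=0100010101100111\cdots$. The abelian complexity of $\mathbf{u}$ is unbounded and $b^{(k)}_{\mathbf{u}}\prec b^{(k+1)}_{\mathbf{u}}$ for all $k\ge1$.
   Context: For words $u,w$, $\binom{u}{w}$ is the number of occurrences of $w$ as a scattered subword of $u$; $u\sim_k v$ if $\binom{u}{x}=\binom{v}{x}$ for all words $x$ of length at most $k$. $b^{(k)}_{\mathbf{x}}(n)$ is the number of $\sim_k$-classes among length-$n$ factors of $\mathbf{x}$ (for $k=1$, the abelian complexity). For $f,g\colon\mathbb{N}\to\mathbb{N}$, $f\prec g$ means $f(n)<g(n)$ for infinitely many $n$. -}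

module Defs where

open import Data.Bool using (Bool; true; false; if_then_else_)
open import Data.Bool.Properties using (<-strictTotalOrder)
import Data.Bool.Properties as BoolP
open import Data.Nat using (ℕ; zero; suc; _+_; _≤_; _<_)
open import Data.Fin using (Fin)
open import Data.List using (List; []; _∷_; _++_; concat; concatMap; map; length; upTo)
open import Data.Product using (_×_; _,_; proj₁; proj₂; Σ; ∃)
open import Relation.Binary.PropositionalEquality using (_≡_; _≢_)
open import Relation.Nullary using (¬_)
import Data.List.Relation.Binary.Lex.Strict as LexS
import Data.List.Sort.MergeSort as MS
open import Data.List.Sort.Base using (SortingAlgorithm)

-- Alphabet {0,1} is Bool with 0 = false, 1 = true (so 0 < 1 as false < true).
Word : Set
Word = List Bool

lexOrder = LexS.≤-decTotalOrder BoolP.<-strictTotalOrder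

open SortingAlgorithm (MS.mergeSort lexOrder) using (sort)

-- D k (as a list of words, each word listed once) together with u k.
-- Du k = (D_k , u_k) where u_k = concatenation of the words of D_k in
-- lexicographic order.
DList : ℕ → List Word
uWord : ℕ → Word

DList zero = (false ∷ []) ∷ (true ∷ []) ∷ []
DList (suc k) =
  concatMap (λ w₁ → map (λ w₂ → uWord k ++ w₁ ++ w₂) (DList k)) (DList k)

uWord k = concat (sort (DList k))

-- n-th letter of a finite word (default 0 when out of range)
nth : Word → ℕ → Bool
nth []      _       = false
nth (a ∷ w) zero    = a
nth (a ∷ w) (suc n) = nth w n

InfWord : Set
InfWord = ℕ → Bool

-- The limit word u: its n-th letter is the n-th letter of u_n
-- (|u_n| > n, and u_k is a prefix of u_{k+1}; the theorem below also
-- asserts that every u_k is a prefix of 𝐮).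
𝐮 : InfWord
𝐮 n = nth (uWord n) n

factor : InfWord → ℕ → ℕ → Word
factor x i n = map (λ j → x (i + j)) (upTo n)

eqB : Bool → Bool → Bool
eqB false false = true
eqB true  true  = true
eqB _     _     = false

-- binomial coefficient of words: number of occurrences of w as a
-- scattered subword of u
binom : Word → Word → ℕ
binom u       []      = 1
binom []      (b ∷ w) = 0
binom (a ∷ u) (b ∷ w) = (if eqB a b then binom u w else 0) + binom u (b ∷ w)

_∼[_]_ : Word → ℕ → Word → Set
u ∼[ k ] v = (x : Word) → length x ≤ k → binom u x ≡ binom v x

-- BCount x k n m : "b^(k)_x(n) = m", i.e. the length-n factors of x fall
-- into exactly m ∼_k-classes: there are m positions whose factors are
-- pairwise inequivalent, and every length-n factor is equivalent to one
-- of them.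
BCount : InfWord → ℕ → ℕ → ℕ → Set
BCount x k n m =
  Σ (Fin m → ℕ) λ p →
    ((i j : Fin m) → i ≢ j → ¬ (factor x (p i) n ∼[ k ] factor x (p j) n))
    × ((i : ℕ) → ∃ λ j → factor x i n ∼[ k ] factor x (p j) n)

BPrec : InfWord → ℕ → ℕ → Set
BPrec x k k' = (N : ℕ) → ∃ λ n → N ≤ n × ∃ λ a → ∃ λ b →
  BCount x k n a × BCount x k' n b × a < b

{-# OPTIONS --safe #-}

-- If X ∼_k Y then XY ∼_{k+1} YX, because in the convolution formula for binom (XY) w all proper
-- factorisations of w cancel.  Starting from X = 0, Y = 1 and replacing (X , Y) by
-- (u_k X Y , u_k Y X) therefore stays in D_k and gives X ∼_k Y; the difference of the coefficients
-- at 0 1^k gets multiplied, up to sign, by the number of 1s of X, so X ≁_{k+1} Y.  Common prefixes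
-- change neither fact, so passing to u_m w X and u_m w Y yields such pairs in D_m for every
-- m ≥ k, all of whose words are factors of 𝐮.  Since a factor of length n lies in some w₁w₂ with
-- w₁, w₂ ∈ D_n, and hence in u_{n+1}, the classes can be counted effectively; ∼_{k+1} refines ∼_k,
-- strictly as soon as such a pair exists.  For the abelian complexity, the numbers of 1s in the
-- words of D_k, which all have the same length, cover k + 2 consecutive values.
module Submission where

open import Defs
open import Data.Nat using (ℕ; suc; _≤_; _<_)
open import Data.List using (length)
open import Data.Product using (_×_; ∃)
open import Relation.Binary.PropositionalEquality using (_≡_)

open import Data.Nat using (zero; _+_; _*_; z≤n; s≤s; ≢-nonZero)
open import Data.Nat.Properties renaming (_≟_ to _≟ℕ_)
open import Data.Nat.Solver using (module +-*-Solver)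
open import Data.Bool using (Bool; true; false; if_then_else_)
open import Data.Fin using (Fin; zero; suc; toℕ; _≟_)
open import Data.Fin.Properties using (any?; injective⇒≤; toℕ-injective; toℕ≤pred[n])
open import Data.Vec.Functional using () renaming (_∷_ to _◂_)
open import Data.List using (List; []; _∷_; _++_; concat; map; upTo; applyUpTo; replicate; take; drop)
open import Data.List.Properties
  using (map-upTo; ++-assoc; ++-identityʳ; length-map; length-upTo; length-++; length-take;
         length-drop; length-replicate; take++drop≡id; concat-++; ∷-injective)
open import Data.List.Membership.Propositional using (_∈_; find; lose)
open import Data.List.Membership.Propositional.Properties
  using (∈-map⁺; ∈-map⁻; ∈-concatMap⁺; ∈-concatMap⁻)
open import Data.List.Relation.Unary.Any using (here; there)
open import Data.List.Relation.Unary.All as All using (All; []; _∷_)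
import Data.List.Relation.Unary.All.Properties as All
open import Data.List.Relation.Binary.Permutation.Propositional using (↭-sym)
open import Data.List.Relation.Binary.Permutation.Propositional.Properties using (∈-resp-↭)
open import Data.List.Sort.Base using (module SortingAlgorithm)
import Data.List.Sort.MergeSort as MergeSort
open import Data.Product using (∃₂; _,_; proj₁; proj₂; Σ)
open import Data.Sum using (_⊎_; inj₁; inj₂)
open import Function using (_∘_)
open import Relation.Nullary using (¬_; Dec; yes; no; contradiction)
open import Relation.Nullary.Decidable using (map′; _×-dec_)
open import Relation.Binary.PropositionalEquality
  using (_≢_; refl; sym; trans; cong; cong₂; subst; subst₂; module ≡-Reasoning)

open SortingAlgorithm (MergeSort.mergeSort lexOrder) using (sort; sort-↭)

-- Binomial coefficients of concatenations

-- Stated for arbitrary functions because recursion on words leads to shifts `f ∘ (b ∷_)`, which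
-- need not be of the form `binom u`. For `f = binom u` and `g = binom v` it unfolds to
-- `u ∼[ k ] v`.
Agree : ℕ → (Word → ℕ) → (Word → ℕ) → Set
Agree k f g = ∀ x → length x ≤ k → f x ≡ g x

-- Sum of f x * g y over all factorisations w = x ++ y.
conv : (Word → ℕ) → (Word → ℕ) → Word → ℕ
conv f g []      = f [] * g []
conv f g (b ∷ w) = f [] * g (b ∷ w) + conv (f ∘ (b ∷_)) g w

conv-zeroˡ : ∀ g w → conv (λ _ → 0) g w ≡ 0
conv-zeroˡ g []      = refl
conv-zeroˡ g (_ ∷ w) = conv-zeroˡ g w

conv-distribˡ-+ : ∀ f f′ g w → conv (λ x → f x + f′ x) g w ≡ conv f g w + conv f′ g w
conv-distribˡ-+ f f′ g []      = *-distribʳ-+ (g []) (f []) (f′ [])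
conv-distribˡ-+ f f′ g (b ∷ w) = begin
  (f [] + f′ []) * c + conv (λ x → f (b ∷ x) + f′ (b ∷ x)) g w
    ≡⟨ cong ((f [] + f′ []) * c +_) (conv-distribˡ-+ (f ∘ (b ∷_)) (f′ ∘ (b ∷_)) g w) ⟩
  (f [] + f′ []) * c + (s + s′)
    ≡⟨ solve 5 (λ a a′ c s s′ → (a :+ a′) :* c :+ (s :+ s′) := (a :* c :+ s) :+ (a′ :* c :+ s′))
         refl (f []) (f′ []) c s s′ ⟩
  (f [] * c + s) + (f′ [] * c + s′) ∎
  where
  open ≡-Reasoning
  open +-*-Solver
  c  = g (b ∷ w)
  s  = conv (f ∘ (b ∷_)) g w
  s′ = conv (f′ ∘ (b ∷_)) g w

conv-if : ∀ c f g w → conv (λ x → if c then f x else 0) g w ≡ (if c then conv f g w else 0)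
conv-if true  f g w = refl
conv-if false f g w = conv-zeroˡ g w

binom-[] : ∀ u → binom u [] ≡ 1
binom-[] []      = refl
binom-[] (_ ∷ _) = refl

-- An occurrence of `w` in `u ++ v` cuts `w` into the part read in `u` and the part read in `v`.
binom-++ : ∀ u v w → binom (u ++ v) w ≡ conv (binom u) (binom v) w
binom-++ []      v []      = refl
binom-++ []      v (b ∷ w) = sym (trans (cong (1 * binom v (b ∷ w) +_) (conv-zeroˡ (binom v) w))
                                        (trans (+-identityʳ _) (*-identityˡ _)))
binom-++ (a ∷ u) v []      = refl
binom-++ (a ∷ u) v (b ∷ w) = begin
  (if eqB a b then binom (u ++ v) w else 0) + binom (u ++ v) (b ∷ w)
    ≡⟨ cong₂ (λ s t → (if eqB a b then s else 0) + t) (binom-++ u v w) (binom-++ u v (b ∷ w)) ⟩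
  p + (1 * q + r)
    ≡⟨ solve 3 (λ p q r → p :+ (q :+ r) := q :+ (p :+ r)) refl p (1 * q) r ⟩
  1 * q + (p + r)
    ≡⟨ cong (λ s → 1 * q + (s + r)) (conv-if (eqB a b) (binom u) (binom v) w) ⟨
  1 * q + (conv (λ x → if eqB a b then binom u x else 0) (binom v) w + r)
    ≡⟨ cong (1 * q +_)
         (conv-distribˡ-+ (λ x → if eqB a b then binom u x else 0) (binom u ∘ (b ∷_)) (binom v) w) ⟨
  conv (binom (a ∷ u)) (binom v) (b ∷ w) ∎
  where
  open ≡-Reasoning
  open +-*-Solver
  p = if eqB a b then conv (binom u) (binom v) w else 0
  q = binom v (b ∷ w)
  r = conv (binom u ∘ (b ∷_)) (binom v) w

conv-congʳ : ∀ {k f g} h → Agree k f g → Agree k (conv h f) (conv h g)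
conv-congʳ h f≈g []      l = cong (h [] *_) (f≈g [] l)
conv-congʳ h f≈g (b ∷ w) l =
  cong₂ (λ s t → h [] * s + t) (f≈g (b ∷ w) l) (conv-congʳ (h ∘ (b ∷_)) f≈g w (<⇒≤ l))

-- For |w| = k + 1 only the extreme factorisation feels the difference between
-- f and g: conv h f w − conv h g w = h [] * (f w − g w), stated without subtraction.
conv-nextʳ : ∀ {k f g} h → Agree k f g → ∀ w → length w ≤ suc k →
             conv h f w + h [] * g w ≡ conv h g w + h [] * f w
conv-nextʳ {f = f} {g} h f≈g []      l = +-comm (h [] * f []) (h [] * g [])
conv-nextʳ {f = f} {g} h f≈g (b ∷ w) (s≤s l) =
  trans (cong (λ s → h [] * f (b ∷ w) + s + h [] * g (b ∷ w)) (conv-congʳ (h ∘ (b ∷_)) f≈g w l))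
        (solve 3 (λ a s c → a :+ s :+ c := c :+ s :+ a) refl
           (h [] * f (b ∷ w)) (conv (h ∘ (b ∷_)) g w) (h [] * g (b ∷ w)))
  where open +-*-Solver

-- Mirror image of `conv-nextʳ`. Here the recursion shifts the functions being compared, so each
-- letter lowers the bound `k`, and `k` has to be split along with `w`.
conv-nextˡ : ∀ {k f g} h → Agree k f g → ∀ w → length w ≤ suc k →
             conv f h w + g w * h [] ≡ conv g h w + f w * h []
conv-nextˡ {k}     {f} {g} h f≈g []      l = +-comm (f [] * h []) (g [] * h [])
conv-nextˡ {zero}  {f} {g} h f≈g (b ∷ []) l rewrite f≈g [] z≤n =
  solve 3 (λ p s t → p :+ s :+ t := p :+ t :+ s) refl
    (g [] * h (b ∷ [])) (f (b ∷ []) * h []) (g (b ∷ []) * h [])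
  where open +-*-Solver
conv-nextˡ {zero}  h f≈g (_ ∷ _ ∷ _) (s≤s ())
conv-nextˡ {suc k} {f} {g} h f≈g (b ∷ w) (s≤s l) rewrite f≈g [] z≤n = begin
  (c + conv (f ∘ (b ∷_)) h w) + g (b ∷ w) * h []
    ≡⟨ +-assoc c _ _ ⟩
  c + (conv (f ∘ (b ∷_)) h w + g (b ∷ w) * h [])
    ≡⟨ cong (c +_) (conv-nextˡ h (λ x x≤k → f≈g (b ∷ x) (s≤s x≤k)) w l) ⟩
  c + (conv (g ∘ (b ∷_)) h w + f (b ∷ w) * h [])
    ≡⟨ +-assoc c _ _ ⟨
  (c + conv (g ∘ (b ∷_)) h w) + f (b ∷ w) * h [] ∎
  where
  open ≡-Reasoning
  c = g [] * h (b ∷ w)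

-- Both products are compared with `X ++ X`: at a word of length at most k + 1, replacing either
-- factor `X` by `Y` changes the coefficient by the same amount, `g w` minus `f w`.
∼-swap : ∀ {k} X Y → X ∼[ k ] Y → (X ++ Y) ∼[ suc k ] (Y ++ X)
∼-swap X Y X∼Y w l = begin
  binom (X ++ Y) w ≡⟨ binom-++ X Y w ⟩
  conv f g w       ≡⟨ +-cancelʳ-≡ (1 * f w) _ _ fg≡gf ⟩
  conv g f w       ≡⟨ binom-++ Y X w ⟨
  binom (Y ++ X) w ∎
  where
  open ≡-Reasoning
  f = binom X
  g = binom Y
  fg≡gf : conv f g w + 1 * f w ≡ conv g f w + 1 * f w
  fg≡gf = begin
    conv f g w + 1 * f w    ≡⟨ conv-nextʳ f X∼Y w l ⟨
    conv f f w + 1 * g w    ≡⟨ cong (conv f f w +_) (*-comm 1 (g w)) ⟩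
    conv f f w + g w * f [] ≡⟨ conv-nextˡ f X∼Y w l ⟩
    conv g f w + f w * f [] ≡⟨ cong (conv g f w +_) (*-comm (f w) 1) ⟩
    conv g f w + 1 * f w    ∎

∼-++ˡ : ∀ {k} p {X Y} → X ∼[ k ] Y → (p ++ X) ∼[ k ] (p ++ Y)
∼-++ˡ []      X∼Y = X∼Y
∼-++ˡ (a ∷ p) {X} {Y} X∼Y = step
  where
  pX∼pY = ∼-++ˡ p X∼Y
  step : (a ∷ p ++ X) ∼[ _ ] (a ∷ p ++ Y)
  step []      l = refl
  step (b ∷ x) l = cong₂ (λ s t → (if eqB a b then s else 0) + t) (pX∼pY x (<⇒≤ l)) (pX∼pY (b ∷ x) l)

-- A letter put in front adds to the coefficient at `b ∷ w` either 0 or the coefficient at the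
-- shorter word `w`, on which both sides already agree.
binom-++ˡ-cancel : ∀ {k X Y} p w → X ∼[ k ] Y → length w ≤ suc k →
                   binom (p ++ X) w ≡ binom (p ++ Y) w → binom X w ≡ binom Y w
binom-++ˡ-cancel []      w       X∼Y l       eq = eq
binom-++ˡ-cancel (a ∷ p) []      X∼Y l       eq = X∼Y [] z≤n
binom-++ˡ-cancel {X = X} {Y} (a ∷ p) (b ∷ w) X∼Y (s≤s l) eq =
  binom-++ˡ-cancel p (b ∷ w) X∼Y (s≤s l)
    (+-cancelˡ-≡ (if eqB a b then binom (p ++ Y) w else 0) _ _
      (trans (cong (λ s → (if eqB a b then s else 0) + binom (p ++ X) (b ∷ w)) (sym (∼-++ˡ p X∼Y w l))) eq))

-- The words 0 1^k, which separate ∼_{k+1} from ∼_k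

ones : ℕ → Word
ones i = replicate i true

-- A word with m letters 1 has coefficient m choose i at 1^i; `binom (ones m) (ones i)` stands for
-- that number.
binom-ones : ∀ X Y → binom X (ones 1) ≡ binom Y (ones 1) → ∀ i → binom X (ones i) ≡ binom Y (ones i)
binom-ones X Y eq i = trans (binom-onesCount X i)
  (trans (cong (λ m → binom (ones m) (ones i)) eq) (sym (binom-onesCount Y i)))
  where
  binom-onesCount : ∀ u i → binom u (ones i) ≡ binom (ones (binom u (ones 1))) (ones i)
  binom-onesCount u           zero    = trans (binom-[] u) (sym (binom-[] (ones (binom u (ones 1)))))
  binom-onesCount []          (suc i) = refl
  binom-onesCount (false ∷ u) (suc i) = binom-onesCount u (suc i)
  binom-onesCount (true ∷ u)  (suc i)
    rewrite binom-[] u = cong₂ _+_ (binom-onesCount u i) (binom-onesCount u (suc i))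

conv-ones-congʳ : ∀ f {g h} → (∀ i → g (ones i) ≡ h (ones i)) → ∀ i → conv f g (ones i) ≡ conv f h (ones i)
conv-ones-congʳ f eq zero    = cong (f [] *_) (eq 0)
conv-ones-congʳ f eq (suc i) = cong₂ (λ s t → f [] * s + t) (eq (suc i)) (conv-ones-congʳ (f ∘ (true ∷_)) eq i)

-- Only the last two factorisations of 1^(j+1) feel the difference between f and g;
-- both sides are rearranged to avoid subtraction.
conv-ones-next : ∀ f g h j → (∀ i → i < j → f (ones i) ≡ g (ones i)) →
  conv f h (ones (suc j)) + (g (ones j) * h (ones 1) + g (ones (suc j)) * h [])
    ≡ conv g h (ones (suc j)) + (f (ones j) * h (ones 1) + f (ones (suc j)) * h [])
conv-ones-next f g h zero    eq = +-comm (f [] * h (ones 1) + f (ones 1) * h []) _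
conv-ones-next f g h (suc j) eq rewrite eq 0 (s≤s z≤n) =
  trans (+-assoc c _ _)
    (trans (cong (c +_) (conv-ones-next (f ∘ (true ∷_)) (g ∘ (true ∷_)) h j (λ i i<j → eq (suc i) (s≤s i<j))))
      (sym (+-assoc c _ _)))
  where c = g [] * h (ones (suc (suc j)))

-- Without subtraction, the computation shows that the coefficients of XY and YX at 0 1^(j+1) differ
-- by the difference of those of X and Y at 0 1^j, times the number of 1s of X.
swap-separates : ∀ {j} X Y → 1 ≤ j → X ∼[ j ] Y → binom X (ones 1) ≢ 0 →
  binom X (false ∷ ones j) ≢ binom Y (false ∷ ones j) →
  binom (X ++ Y) (false ∷ ones (suc j)) ≢ binom (Y ++ X) (false ∷ ones (suc j))
swap-separates {j} X Y 1≤j X∼Y 1∈X X≢Y eq =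
  X≢Y (sym (*-cancelʳ-≡ (g (false ∷ ones j)) (f (false ∷ ones j)) (f (ones 1)) {{≢-nonZero 1∈X}} reduced))
  where
  open ≡-Reasoning
  open +-*-Solver
  f = binom X
  g = binom Y
  f₀ = f ∘ (false ∷_)
  g₀ = g ∘ (false ∷_)
  n = suc j
  powers : ∀ i → g (ones i) ≡ f (ones i)
  powers i = sym (binom-ones X Y (X∼Y (ones 1) 1≤j) i)
  -- The factorisation with empty left part is split off. In all others the right part is a power of
  -- 1, where `g` may be replaced by `f`.
  balance : g₀ (ones n) + conv f₀ f (ones n) ≡ f₀ (ones n) + conv g₀ f (ones n)
  balance = begin
    g₀ (ones n) + conv f₀ f (ones n)
      ≡⟨ cong₂ _+_ (sym (*-identityˡ (g₀ (ones n)))) (sym (conv-ones-congʳ f₀ powers n)) ⟩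
    1 * g₀ (ones n) + conv f₀ g (ones n) ≡⟨ cong (λ c → c * g₀ (ones n) + conv f₀ g (ones n)) (sym (binom-[] X)) ⟩
    conv f g (false ∷ ones n)            ≡⟨ binom-++ X Y (false ∷ ones n) ⟨
    binom (X ++ Y) (false ∷ ones n)      ≡⟨ eq ⟩
    binom (Y ++ X) (false ∷ ones n)      ≡⟨ binom-++ Y X (false ∷ ones n) ⟩
    conv g f (false ∷ ones n)            ≡⟨ cong (λ c → c * f₀ (ones n) + conv g₀ f (ones n)) (binom-[] Y) ⟩
    1 * f₀ (ones n) + conv g₀ f (ones n) ≡⟨ cong (_+ conv g₀ f (ones n)) (*-identityˡ (f₀ (ones n))) ⟩
    f₀ (ones n) + conv g₀ f (ones n)     ∎
  next : conv f₀ f (ones n) + (g₀ (ones j) * f (ones 1) + g₀ (ones n) * 1)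
       ≡ conv g₀ f (ones n) + (f₀ (ones j) * f (ones 1) + f₀ (ones n) * 1)
  next = subst (λ c → conv f₀ f (ones n) + (g₀ (ones j) * f (ones 1) + g₀ (ones n) * c)
                    ≡ conv g₀ f (ones n) + (f₀ (ones j) * f (ones 1) + f₀ (ones n) * c)) (binom-[] X)
    (conv-ones-next f₀ g₀ f j
      (λ i i<j → X∼Y (false ∷ ones i) (subst (_≤ j) (cong suc (sym (length-replicate i))) i<j)))
  -- The terms at `ones n` in `next` cancel against those split off in `balance`; only the
  -- factorisation with left part 0 1^j and right part 1 survives.
  reduced : g₀ (ones j) * f (ones 1) ≡ f₀ (ones j) * f (ones 1)
  reduced = +-cancelˡ-≡ (g₀ (ones n) + conv f₀ f (ones n)) _ _ (begin
    g₀ (ones n) + conv f₀ f (ones n) + g₀ (ones j) * f (ones 1)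
      ≡⟨ solve 3 (λ a b c → a :+ b :+ c := b :+ (c :+ a :* con 1)) refl (g₀ (ones n)) _ _ ⟩
    conv f₀ f (ones n) + (g₀ (ones j) * f (ones 1) + g₀ (ones n) * 1)
      ≡⟨ next ⟩
    conv g₀ f (ones n) + (f₀ (ones j) * f (ones 1) + f₀ (ones n) * 1)
      ≡⟨ solve 3 (λ a b c → b :+ (c :+ a :* con 1) := a :+ b :+ c) refl (f₀ (ones n)) _ _ ⟩
    f₀ (ones n) + conv g₀ f (ones n) + f₀ (ones j) * f (ones 1)
      ≡⟨ cong (_+ f₀ (ones j) * f (ones 1)) balance ⟨
    g₀ (ones n) + conv f₀ f (ones n) + f₀ (ones j) * f (ones 1) ∎)

-- Counting classes

agree? : ∀ k (f g : Word → ℕ) → Dec (Agree k f g)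
agree? zero    f g = map′ (λ { eq [] _ → eq }) (λ f≈g → f≈g [] z≤n) (f [] ≟ℕ g [])
agree? (suc k) f g =
  map′ (λ { (e , _ , _) []          _       → e
          ; (_ , F , _) (false ∷ x) (s≤s l) → F x l
          ; (_ , _ , T) (true ∷ x)  (s≤s l) → T x l })
       (λ f≈g → f≈g [] z≤n , (λ x l → f≈g (false ∷ x) (s≤s l)) , (λ x l → f≈g (true ∷ x) (s≤s l)))
       (f [] ≟ℕ g [] ×-dec
        (agree? k (f ∘ (false ∷_)) (g ∘ (false ∷_)) ×-dec agree? k (f ∘ (true ∷_)) (g ∘ (true ∷_))))

_∼ᶠ[_,_]_ : ℕ → ℕ → ℕ → ℕ → Set
i ∼ᶠ[ k , n ] j = factor 𝐮 i n ∼[ k ] factor 𝐮 j n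

Separated : ∀ k n {m} → (Fin m → ℕ) → Set
Separated k n p = ∀ i j → i ≢ j → ¬ (p i ∼ᶠ[ k , n ] p j)

-- Greedy scan of the positions below `M`, keeping each one inequivalent to all kept before.
-- `factor-recurs` later supplies an `M` that accounts for every position.
representatives : ∀ k n M → ∃ λ m → Σ (Fin m → ℕ) λ p →
                  Separated k n p × (∀ i → i < M → ∃ λ j → i ∼ᶠ[ k , n ] p j)
representatives k n zero = 0 , (λ ()) , (λ ()) , (λ _ ())
representatives k n (suc M) with representatives k n M
... | m , p , sep , cov with any? (λ j → agree? k (binom (factor 𝐮 M n)) (binom (factor 𝐮 (p j) n)))
...   | yes old = m , p , sep , cov′
  where
  cov′ : ∀ i → i < suc M → ∃ λ j → i ∼ᶠ[ k , n ] p j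
  cov′ i i<1+M with m≤n⇒m<n∨m≡n (≤-pred i<1+M)
  ... | inj₁ i<M  = cov i i<M
  ... | inj₂ refl = old
...   | no new = suc m , M ◂ p , sep′ , cov′
  where
  sep′ : Separated k n (M ◂ p)
  sep′ zero    zero    i≢j _ = i≢j refl
  sep′ zero    (suc j) _   e = new (j , e)
  sep′ (suc i) zero    _   e = new (i , λ x l → sym (e x l))
  sep′ (suc i) (suc j) i≢j e = sep i j (i≢j ∘ cong suc) e
  cov′ : ∀ i → i < suc M → ∃ λ j → i ∼ᶠ[ k , n ] (M ◂ p) j
  cov′ i i<1+M with m≤n⇒m<n∨m≡n (≤-pred i<1+M)
  ... | inj₁ i<M  = let j , e = cov i i<M in suc j , e
  ... | inj₂ refl = zero , λ _ _ → refl

-- Pigeonhole: sending each position to the index of its class is injective.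
separated-≤ : ∀ {k n m l} → BCount 𝐮 k n m → (q : Fin l → ℕ) → Separated k n q → l ≤ m
separated-≤ {k} {n} (p , _ , cov) q sep = injective⇒≤ class-injective
  where
  class-injective : ∀ {i j} → proj₁ (cov (q i)) ≡ proj₁ (cov (q j)) → i ≡ j
  class-injective {i} {j} eq with i ≟ j
  ... | yes i≡j = i≡j
  ... | no  i≢j = contradiction
    (λ x l → trans (proj₂ (cov (q i)) x l)
               (trans (cong (λ c → binom (factor 𝐮 (p c) n) x) eq) (sym (proj₂ (cov (q j)) x l))))
    (sep i j i≢j)

-- Of two factors merged by ∼_k and separated by ∼_{k+1}, one is ∼_{k+1}-inequivalent to the
-- representative of their common ∼_k-class, hence to all representatives.
bcount-< : ∀ {k n a b} i j → i ∼ᶠ[ k , n ] j → ¬ (i ∼ᶠ[ suc k , n ] j) →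
           BCount 𝐮 k n a → BCount 𝐮 (suc k) n b → a < b
bcount-< {k} {n} {a} i j i∼j i≁j (p , sep , cov) B = by-new new
  where
  c = proj₁ (cov i)
  new : ∃ λ m → m ∼ᶠ[ k , n ] p c × ¬ (m ∼ᶠ[ suc k , n ] p c)
  new with agree? (suc k) (binom (factor 𝐮 i n)) (binom (factor 𝐮 (p c) n))
  ... | no  i≁pc = i , proj₂ (cov i) , i≁pc
  ... | yes i∼pc = j , (λ x l → trans (sym (i∼j x l)) (proj₂ (cov i) x l))
                     , (λ j∼pc → i≁j (λ x l → trans (i∼pc x l) (sym (j∼pc x l))))
  by-new : (∃ λ m → m ∼ᶠ[ k , n ] p c × ¬ (m ∼ᶠ[ suc k , n ] p c)) → a < _
  by-new (m , m∼pc , m≁pc) = separated-≤ B (m ◂ p) sep′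
    where
    m≁ : ∀ d → ¬ (m ∼ᶠ[ suc k , n ] p d)
    m≁ d m∼pd with c ≟ d
    ... | yes refl = m≁pc m∼pd
    ... | no  c≢d  = sep c d c≢d (λ x l → trans (sym (m∼pc x l)) (m∼pd x (m≤n⇒m≤1+n l)))
    sep′ : Separated (suc k) n (m ◂ p)
    sep′ zero    zero    i≢j _ = i≢j refl
    sep′ zero    (suc d) _   e = m≁ d e
    sep′ (suc d) zero    _   e = m≁ d (λ x l → sym (e x l))
    sep′ (suc d) (suc e) d≢e q = sep d e (d≢e ∘ cong suc) (λ x l → q x (m≤n⇒m≤1+n l))

-- Factors

nth-++ˡ : ∀ y s {j} → j < length y → nth (y ++ s) j ≡ nth y j
nth-++ˡ (a ∷ y) s {zero}  l       = refl
nth-++ˡ (a ∷ y) s {suc j} (s≤s l) = nth-++ˡ y s l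

nth-++ʳ : ∀ p y j → nth (p ++ y) (length p + j) ≡ nth y j
nth-++ʳ []      y j = refl
nth-++ʳ (_ ∷ p) y j = nth-++ʳ p y j

applyUpTo-nth : ∀ (x : ℕ → Bool) y → (∀ {j} → j < length y → x j ≡ nth y j) → applyUpTo x (length y) ≡ y
applyUpTo-nth x []      eq = refl
applyUpTo-nth x (a ∷ y) eq = cong₂ _∷_ (eq (s≤s z≤n)) (applyUpTo-nth (x ∘ suc) y (λ l → eq (s≤s l)))

factor-nth : ∀ x {w} p y s → (∀ i → i < length w → nth w i ≡ x i) → w ≡ p ++ y ++ s →
             factor x (length p) (length y) ≡ y
factor-nth x p y s pre refl =
  trans (map-upTo (λ j → x (length p + j)) (length y))
    (applyUpTo-nth (λ j → x (length p + j)) y λ {j} l → begin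
      x (length p + j)                 ≡⟨ pre (length p + j) (inside l) ⟨
      nth (p ++ y ++ s) (length p + j) ≡⟨ nth-++ʳ p (y ++ s) j ⟩
      nth (y ++ s) j                   ≡⟨ nth-++ˡ y s l ⟩
      nth y j                          ∎)
  where
  open ≡-Reasoning
  inside : ∀ {j} → j < length y → length p + j < length (p ++ y ++ s)
  inside l rewrite length-++ p {y ++ s} | length-++ y {s} =
    +-monoʳ-< (length p) (<-≤-trans l (m≤m+n (length y) (length s)))

infix 4 _⊑_
_⊑_ : Word → Word → Set
x ⊑ y = ∃₂ λ p s → y ≡ p ++ x ++ s

⊑-++ˡ : ∀ {x y} u → x ⊑ y → x ⊑ u ++ y
⊑-++ˡ {x} u (p , s , refl) = u ++ p , s , sym (++-assoc u p (x ++ s))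

⊑-++ʳ : ∀ {x y} v → x ⊑ y → x ⊑ y ++ v
⊑-++ʳ {x} v (p , s , refl) =
  p , s ++ v , trans (++-assoc p (x ++ s) v) (cong (p ++_) (++-assoc x s v))

⊑-refl : ∀ {x} → x ⊑ x
⊑-refl {x} = [] , [] , sym (++-identityʳ x)

⊑-trans : ∀ {x y z} → x ⊑ y → y ⊑ z → x ⊑ z
⊑-trans x⊑y (p , s , refl) = ⊑-++ˡ p (⊑-++ʳ s x⊑y)

∈⇒⊑-concat : ∀ {w ws} → w ∈ ws → w ⊑ concat ws
∈⇒⊑-concat {ws = _ ∷ ws} (here refl) = ⊑-++ʳ (concat ws) ⊑-refl
∈⇒⊑-concat {ws = v ∷ _}  (there w∈)  = ⊑-++ˡ v (∈⇒⊑-concat w∈)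

-- Levi's lemma for two factorisations of one word.
++-overlap : ∀ p {q} r {s : Word} → p ++ q ≡ r ++ s →
             (∃ λ t → p ≡ r ++ t × s ≡ t ++ q) ⊎ (∃ λ t → r ≡ p ++ t × q ≡ t ++ s)
++-overlap []      r       eq = inj₂ (r , refl , eq)
++-overlap (a ∷ p) []      eq = inj₁ (a ∷ p , refl , sym eq)
++-overlap (a ∷ p) (b ∷ r) eq with ∷-injective eq
... | refl , eq′ with ++-overlap p r eq′
...   | inj₁ (t , refl , q) = inj₁ (t , refl , q)
...   | inj₂ (t , refl , q) = inj₂ (t , refl , q)

++-prefix : ∀ x {s : Word} y {z} → x ++ s ≡ y ++ z → length x ≤ length y → ∃ λ t → y ≡ x ++ t
++-prefix []      y       eq l       = y , refl
++-prefix (a ∷ x) (b ∷ y) eq (s≤s l) with ∷-injective eq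
... | refl , eq′ = let t , e = ++-prefix x y eq′ l in t , cong (a ∷_) e

-- A factor no longer than the blocks meets at most two consecutive ones.
⊑-concat⇒⊑-pair : ∀ {P : Word → Set} {ℓ} → (∀ {w} → P w → length w ≡ ℓ) →
  ∀ x → 0 < length x → length x ≤ ℓ →
  ∀ {ws} → All P ws → x ⊑ concat ws → ∃₂ λ w w′ → P w × P w′ × x ⊑ w ++ w′
⊑-concat⇒⊑-pair len (_ ∷ _) _ x≤ℓ [] ([] , _ , ())
⊑-concat⇒⊑-pair len (_ ∷ _) _ x≤ℓ [] (_ ∷ _ , _ , ())
⊑-concat⇒⊑-pair len x 0<x x≤ℓ {w ∷ ws} (Pw ∷ Pws) (p , s , eq) with ++-overlap p w (sym eq)
... | inj₁ (t , _ , eq′) = ⊑-concat⇒⊑-pair len x 0<x x≤ℓ Pws (t , s , eq′)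
... | inj₂ (t , refl , eq′) with Pws
-- In the last block `x` already lies inside `w`, so any block may serve as second component.
...   | [] = w , w , Pw , Pw , ⊑-++ʳ w (p , s , cong (p ++_) (trans (sym (++-identityʳ t)) (sym eq′)))
...   | _∷_ {v} {vs} Pv _ = w , v , Pw , Pv , in-two
  where
  x≤tv : length x ≤ length (t ++ v)
  x≤tv = ≤-trans (subst (length x ≤_) (sym (len Pv)) x≤ℓ)
           (subst (length v ≤_) (sym (length-++ t)) (m≤n+m (length v) (length t)))
  in-two : x ⊑ (p ++ t) ++ v
  in-two with ++-prefix x (t ++ v) (trans eq′ (sym (++-assoc t v (concat vs)))) x≤tv
  ... | r , tv≡xr = p , r , trans (++-assoc p t v) (cong (p ++_) tv≡xr)

-- The sets D_k and the words u_k

D⊆sorted : ∀ k {w} → w ∈ DList k → w ∈ sort (DList k)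
D⊆sorted k = ∈-resp-↭ (↭-sym (sort-↭ (DList k)))

sorted⊆D : ∀ k {w} → w ∈ sort (DList k) → w ∈ DList k
sorted⊆D k = ∈-resp-↭ (sort-↭ (DList k))

D⊑u : ∀ k {w} → w ∈ DList k → w ⊑ uWord k
D⊑u k w∈D = ∈⇒⊑-concat (D⊆sorted k w∈D)

D-step : ∀ k {w₁ w₂} → w₁ ∈ DList k → w₂ ∈ DList k → uWord k ++ w₁ ++ w₂ ∈ DList (suc k)
D-step k {w₁} w₁∈ w₂∈ =
  ∈-concatMap⁺ (λ v₁ → map (λ v₂ → uWord k ++ v₁ ++ v₂) (DList k))
    (lose w₁∈ (∈-map⁺ (λ v₂ → uWord k ++ w₁ ++ v₂) w₂∈))

D-unstep : ∀ k {w} → w ∈ DList (suc k) →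
           ∃₂ λ w₁ w₂ → w₁ ∈ DList k × w₂ ∈ DList k × w ≡ uWord k ++ w₁ ++ w₂
D-unstep k w∈ with find (∈-concatMap⁻ (λ v₁ → map (λ v₂ → uWord k ++ v₁ ++ v₂) (DList k)) w∈)
... | w₁ , w₁∈ , w∈map with ∈-map⁻ (λ v₂ → uWord k ++ w₁ ++ v₂) w∈map
...   | w₂ , w₂∈ , eq = w₁ , w₂ , w₁∈ , w₂∈ , eq

D-inhabited : ∀ k → ∃ λ w → w ∈ DList k
D-inhabited zero    = false ∷ [] , here refl
D-inhabited (suc k) = let _ , w∈ = D-inhabited k in _ , D-step k w∈ w∈

-- The common length of the words of D_k.
ℓ : ℕ → ℕ
ℓ zero    = 1
ℓ (suc k) = length (uWord k) + (ℓ k + ℓ k)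

D-length : ∀ k {w} → w ∈ DList k → length w ≡ ℓ k
D-length zero    (here refl)         = refl
D-length zero    (there (here refl)) = refl
D-length (suc k) w∈ with D-unstep k w∈
... | w₁ , w₂ , w₁∈ , w₂∈ , refl =
  trans (length-++ (uWord k)) (cong (length (uWord k) +_)
    (trans (length-++ w₁) (cong₂ _+_ (D-length k w₁∈) (D-length k w₂∈))))

⊑-length : ∀ {x y} → x ⊑ y → length x ≤ length y
⊑-length {x} (p , s , refl) rewrite length-++ p {x ++ s} | length-++ x {s} =
  ≤-trans (m≤m+n (length x) (length s)) (m≤n+m _ (length p))

k<ℓ : ∀ k → k < ℓ k
k<ℓ zero    = s≤s z≤n
k<ℓ (suc k) = ≤-trans (+-mono-≤ (≤-<-trans z≤n (k<ℓ k)) (k<ℓ k)) (m≤n+m (ℓ k + ℓ k) (length (uWord k)))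

k<u : ∀ k → k < length (uWord k)
k<u k = let _ , w∈ = D-inhabited k in
  <-≤-trans (subst (k <_) (sym (D-length k w∈)) (k<ℓ k)) (⊑-length (D⊑u k w∈))

-- Every word of D_(k+1) begins with u_k, in particular the one listed first.
u-prefix-step : ∀ k → ∃ λ s → uWord (suc k) ≡ uWord k ++ s
u-prefix-step k with sort (DList (suc k)) | D⊆sorted (suc k) | sorted⊆D (suc k)
... | []     | ⊆sorted | _  with () ← ⊆sorted (proj₂ (D-inhabited (suc k)))
... | w ∷ ws | _       | ⊆D with D-unstep k (⊆D (here refl))
...   | w₁ , w₂ , _ , _ , refl = _ , ++-assoc (uWord k) (w₁ ++ w₂) (concat ws)

u-prefix : ∀ d k → ∃ λ s → uWord (d + k) ≡ uWord k ++ s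
u-prefix zero    k = [] , sym (++-identityʳ (uWord k))
u-prefix (suc d) k with u-prefix d k | u-prefix-step (d + k)
... | s , eq | s′ , eq′ = s ++ s′ , trans eq′ (trans (cong (_++ s′) eq) (++-assoc (uWord k) s s′))

nth-u-stable : ∀ d k i → i < length (uWord k) → nth (uWord (d + k)) i ≡ nth (uWord k) i
nth-u-stable d k i l with u-prefix d k
... | s , eq = trans (cong (λ w → nth w i) eq) (nth-++ˡ (uWord k) s l)

-- `𝐮 i` is read off `uWord i`, which is long enough by `k<u`; both `uWord i` and `uWord k` are
-- prefixes of `uWord (i + k)`.
nth-u : ∀ k i → i < length (uWord k) → nth (uWord k) i ≡ 𝐮 i
nth-u k i l = begin
  nth (uWord k) i       ≡⟨ nth-u-stable i k i l ⟨
  nth (uWord (i + k)) i ≡⟨ cong (λ m → nth (uWord m) i) (+-comm i k) ⟩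
  nth (uWord (k + i)) i ≡⟨ nth-u-stable k i i (k<u i) ⟩
  nth (uWord i) i       ∎
  where open ≡-Reasoning

D-occurs : ∀ k {w} → w ∈ DList k → ∃ λ i → factor 𝐮 i (ℓ k) ≡ w
D-occurs k {w} w∈ with D⊑u k w∈
... | p , s , eq = length p ,
  subst (λ n → factor 𝐮 (length p) n ≡ w) (D-length k w∈) (factor-nth 𝐮 p w s (nth-u k) eq)

-- Block decompositions and recurrence of factors

Blocks : ℕ → Word → Set
Blocks k w = ∃ λ ws → All (_∈ DList k) ws × w ≡ concat ws

Blocks-++ : ∀ k {u v} → Blocks k u → Blocks k v → Blocks k (u ++ v)
Blocks-++ k (us , us∈ , refl) (vs , vs∈ , refl) = us ++ vs , All.++⁺ us∈ vs∈ , concat-++ us vs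

Blocks-concat : ∀ k {ws} → All (Blocks k) ws → Blocks k (concat ws)
Blocks-concat k []       = [] , [] , refl
Blocks-concat k (b ∷ bs) = Blocks-++ k b (Blocks-concat k bs)

D-blocks : ∀ d k {w} → w ∈ DList (d + k) → Blocks k w
u-blocks : ∀ d k → Blocks k (uWord (d + k))

D-blocks zero    k {w} w∈ = w ∷ [] , w∈ ∷ [] , sym (++-identityʳ w)
D-blocks (suc d) k w∈ with D-unstep (d + k) w∈
... | _ , _ , w₁∈ , w₂∈ , refl = Blocks-++ k (u-blocks d k) (Blocks-++ k (D-blocks d k w₁∈) (D-blocks d k w₂∈))

u-blocks d k = Blocks-concat k (All.tabulate (λ w∈ → D-blocks d k (sorted⊆D (d + k) w∈)))

⊑-u : ∀ i n d → i + n ≤ length (uWord d) → factor 𝐮 i n ⊑ uWord d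
⊑-u i n d i+n≤ = p , s , trans split (cong (λ z → p ++ z ++ s) (sym y≡))
  where
  p = take i (uWord d)
  y = take n (drop i (uWord d))
  s = drop n (drop i (uWord d))
  split : uWord d ≡ p ++ y ++ s
  split = sym (trans (cong (p ++_) (take++drop≡id n (drop i (uWord d)))) (take++drop≡id i (uWord d)))
  |p| : length p ≡ i
  |p| = trans (length-take i (uWord d)) (m≤n⇒m⊓n≡m (≤-trans (m≤m+n i n) i+n≤))
  |y| : length y ≡ n
  |y| = trans (length-take n (drop i (uWord d)))
          (m≤n⇒m⊓n≡m (subst (n ≤_) (sym (length-drop i (uWord d)))
            (m+n≤o⇒m≤o∸n n (subst (_≤ length (uWord d)) (+-comm i n) i+n≤))))
  y≡ : factor 𝐮 i n ≡ y
  y≡ = subst₂ (λ a b → factor 𝐮 a b ≡ y) |p| |y| (factor-nth 𝐮 p y s (nth-u d) split)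

length-factor : ∀ i n → length (factor 𝐮 i n) ≡ n
length-factor i n = trans (length-map _ (upTo n)) (length-upTo n)

factor-recurs : ∀ n i → ∃ λ j → j < suc (length (uWord (suc n))) × factor 𝐮 i n ≡ factor 𝐮 j n
factor-recurs zero      i = 0 , s≤s z≤n , refl
factor-recurs n@(suc _) i
  -- `uWord (i + n)` is longer than i + n, so it contains the factor, and it is cut into words of
  -- D_n, each longer than n.
  with u-blocks i n
... | ws , ws∈ , u≡
  with ⊑-concat⇒⊑-pair (D-length n) (factor 𝐮 i n)
         (subst (0 <_) (sym (length-factor i n)) (s≤s z≤n))
         (subst (_≤ ℓ n) (sym (length-factor i n)) (<⇒≤ (k<ℓ n)))
         ws∈ (subst (factor 𝐮 i n ⊑_) u≡ (⊑-u i n (i + n) (<⇒≤ (k<u (i + n)))))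
... | w , w′ , w∈ , w′∈ , f⊑
  -- `w ++ w′` ends a word of D_(n+1), and that word occurs in u_(n+1).
  with ⊑-trans (⊑-++ˡ (uWord n) f⊑) (D⊑u (suc n) (D-step n w∈ w′∈))
... | p , s , eq = length p ,
  s≤s (subst (length p ≤_) (sym (trans (cong length eq) (length-++ p))) (m≤m+n (length p) _)) ,
  sym (subst (λ m → factor 𝐮 (length p) m ≡ factor 𝐮 i n) (length-factor i n)
    (factor-nth 𝐮 p (factor 𝐮 i n) s (nth-u (suc n)) eq))

bcount : ∀ k n → ∃ λ m → BCount 𝐮 k n m
bcount k n with representatives k n (suc (length (uWord (suc n))))
... | m , p , sep , cov = m , p , sep , λ i →
  let j , j<M , eq = factor-recurs n i
      c , e        = cov j j<M
  in c , subst (_∼[ k ] factor 𝐮 (p c) n) (sym eq) e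

-- Abelian complexity

binom-ones₁-++ : ∀ u v → binom (u ++ v) (ones 1) ≡ binom u (ones 1) + binom v (ones 1)
binom-ones₁-++ []      v = refl
binom-ones₁-++ (a ∷ u) v rewrite binom-[] (u ++ v) | binom-[] u | binom-ones₁-++ u v =
  sym (+-assoc (if eqB a true then 1 else 0) (binom u (ones 1)) (binom v (ones 1)))

D-weights : ∀ k → ∃ λ c → ∀ i → i ≤ suc k → ∃ λ w → w ∈ DList k × binom w (ones 1) ≡ c + i
D-weights zero = 0 , λ where
  0 _ → false ∷ [] , here refl , refl
  1 _ → true ∷ [] , there (here refl) , refl
  (suc (suc _)) (s≤s ())
D-weights (suc k) with D-weights k
... | c , weights = |u| + (c + c) , next
  where
  |u| = binom (uWord k) (ones 1)
  join : ∀ i e → i ≤ suc k → e ≤ suc k →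
         ∃ λ w → w ∈ DList (suc k) × binom w (ones 1) ≡ |u| + (c + c) + (i + e)
  join i e i≤ e≤ with weights i i≤ | weights e e≤
  ... | w₁ , w₁∈ , eq₁ | w₂ , w₂∈ , eq₂ = uWord k ++ w₁ ++ w₂ , D-step k w₁∈ w₂∈ , (begin
    binom (uWord k ++ w₁ ++ w₂) (ones 1)               ≡⟨ binom-ones₁-++ (uWord k) (w₁ ++ w₂) ⟩
    |u| + binom (w₁ ++ w₂) (ones 1)                    ≡⟨ cong (|u| +_) (binom-ones₁-++ w₁ w₂) ⟩
    |u| + (binom w₁ (ones 1) + binom w₂ (ones 1))      ≡⟨ cong₂ (λ a b → |u| + (a + b)) eq₁ eq₂ ⟩
    |u| + ((c + i) + (c + e))
      ≡⟨ solve 4 (λ u c i e → u :+ ((c :+ i) :+ (c :+ e)) := u :+ (c :+ c) :+ (i :+ e)) refl |u| c i e ⟩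
    |u| + (c + c) + (i + e)                            ∎)
    where
    open ≡-Reasoning
    open +-*-Solver
  -- The sums 0 + 0 and 1 + i suffice: they raise the number of consecutive weights from k + 2 to k
  -- + 3.
  next : ∀ i → i ≤ suc (suc k) → ∃ λ w → w ∈ DList (suc k) × binom w (ones 1) ≡ |u| + (c + c) + i
  next zero    _       = join 0 0 z≤n z≤n
  next (suc i) (s≤s l) = join 1 i (s≤s z≤n) l

-- The number of 1s is the coefficient at a word of length 1, so the B + 2 weights in D_B give as
-- many classes at length `ℓ B`.
abelian-unbounded : ∀ B → ∃ λ n → ∃ λ m → BCount 𝐮 1 n m × B < m
abelian-unbounded B with D-weights B | bcount 1 (ℓ B)
... | c , weights | m , count = ℓ B , m , count , <-trans (n<1+n B) (separated-≤ count pos separated)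
  where
  word : ∀ (i : Fin (suc (suc B))) → ∃ λ w → w ∈ DList B × binom w (ones 1) ≡ c + toℕ i
  word i = weights (toℕ i) (toℕ≤pred[n] i)
  occ : ∀ i → ∃ λ j → factor 𝐮 j (ℓ B) ≡ proj₁ (word i)
  occ i = D-occurs B (proj₁ (proj₂ (word i)))
  pos : Fin (suc (suc B)) → ℕ
  pos i = proj₁ (occ i)
  weight : ∀ i → binom (factor 𝐮 (pos i) (ℓ B)) (ones 1) ≡ c + toℕ i
  weight i = trans (cong (λ w → binom w (ones 1)) (proj₂ (occ i))) (proj₂ (proj₂ (word i)))
  separated : Separated 1 (ℓ B) pos
  separated i j i≢j i∼j = i≢j (toℕ-injective (+-cancelˡ-≡ c _ _
    (trans (sym (weight i)) (trans (i∼j (ones 1) ≤-refl) (weight j)))))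

-- Strict growth

-- Stronger than failure of ∼_(k+1): the separating word of length k + 1 is prescribed, as the
-- induction through `swap-separates` requires.
SeparatedPair : ℕ → Word → Word → Set
SeparatedPair k X Y = X ∼[ k ] Y × binom X (false ∷ ones k) ≢ binom Y (false ∷ ones k)

SeparatedPair-++ˡ : ∀ {k X Y} p → SeparatedPair k X Y → SeparatedPair k (p ++ X) (p ++ Y)
SeparatedPair-++ˡ {k} p (X∼Y , X≢Y) =
  ∼-++ˡ p X∼Y , λ eq → X≢Y (binom-++ˡ-cancel p (false ∷ ones k) X∼Y (s≤s (≤-reflexive (length-replicate k))) eq)

-- The presence of a 1 in `X` is carried along because the next difference is multiplied by the
-- number of 1s of `X`.
swap-pair : ∀ k → ∃₂ λ X Y → X ∈ DList (suc k) × Y ∈ DList (suc k) ×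
            binom X (ones 1) ≢ 0 × SeparatedPair (suc k) X Y
swap-pair zero =
  -- 0 and 1 are only ∼_0, below the reach of `swap-separates`; 01 and 10 are separated directly by
  -- their coefficients 1 and 0 at 01.
  uWord 0 ++ w₀ ++ w₁ , uWord 0 ++ w₁ ++ w₀ ,
  D-step 0 w₀∈ w₁∈ , D-step 0 w₁∈ w₀∈ ,
  (λ eq → contradiction (m+n≡0⇒n≡0 (binom (uWord 0) (ones 1))
    (trans (sym (binom-ones₁-++ (uWord 0) (w₀ ++ w₁))) eq)) λ ()) ,
  SeparatedPair-++ˡ (uWord 0) (∼-swap w₀ w₁ (λ { [] _ → refl ; (_ ∷ _) () }) , λ ())
  where
  w₀ = false ∷ []
  w₁ = true ∷ []
  w₀∈ : w₀ ∈ DList 0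
  w₀∈ = here refl
  w₁∈ : w₁ ∈ DList 0
  w₁∈ = there (here refl)
swap-pair (suc k) with swap-pair k
... | X , Y , X∈ , Y∈ , 1∈X , X∼Y , X≢Y =
  u ++ X ++ Y , u ++ Y ++ X , D-step (suc k) X∈ Y∈ , D-step (suc k) Y∈ X∈ ,
  (λ eq → 1∈X (m+n≡0⇒m≡0 (binom X (ones 1))
    (trans (sym (binom-ones₁-++ X Y))
      (m+n≡0⇒n≡0 (binom u (ones 1)) (trans (sym (binom-ones₁-++ u (X ++ Y))) eq))))) ,
  SeparatedPair-++ˡ u (∼-swap X Y X∼Y , swap-separates X Y (s≤s z≤n) X∼Y 1∈X X≢Y)
  where u = uWord (suc k)

-- Keeps the level of equivalence fixed while the words grow, since strictness is needed at
-- arbitrarily large lengths.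
long-pair : ∀ k d → ∃₂ λ X Y → X ∈ DList (d + suc k) × Y ∈ DList (d + suc k) × SeparatedPair (suc k) X Y
long-pair k zero with swap-pair k
... | X , Y , X∈ , Y∈ , _ , X|Y = X , Y , X∈ , Y∈ , X|Y
long-pair k (suc d) with long-pair k d | D-inhabited (d + suc k)
... | X , Y , X∈ , Y∈ , X|Y | w , w∈ =
  u ++ w ++ X , u ++ w ++ Y , D-step (d + suc k) w∈ X∈ , D-step (d + suc k) w∈ Y∈ ,
  SeparatedPair-++ˡ u (SeparatedPair-++ˡ w X|Y)
  where u = uWord (d + suc k)

strict-growth : ∀ k → 1 ≤ k → BPrec 𝐮 k (suc k)
strict-growth (suc k) _ N with long-pair k N
... | X , Y , X∈ , Y∈ , X∼Y , X≢Y
  with D-occurs (N + suc k) X∈ | D-occurs (N + suc k) Y∈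
     | bcount (suc k) (ℓ (N + suc k)) | bcount (suc (suc k)) (ℓ (N + suc k))
... | i , i≡X | j , j≡Y | a , A | b , B =
  -- The common length of the pair exceeds `N` because `k<ℓ` bounds it below by its index.
  ℓ (N + suc k) , <⇒≤ (≤-<-trans (m≤m+n N (suc k)) (k<ℓ (N + suc k))) , a , b , A , B ,
  bcount-< i j (subst₂ _∼[ suc k ]_ (sym i≡X) (sym j≡Y) X∼Y)
    (λ i∼j → X≢Y (subst₂ _∼[ suc (suc k) ]_ i≡X j≡Y i∼j (false ∷ ones (suc k))
                     (s≤s (≤-reflexive (length-replicate (suc k)))))) A B

theorem6p4 : ((k i : ℕ) → i < length (uWord k) → nth (uWord k) i ≡ 𝐮 i)
    × ((B : ℕ) → ∃ λ n → ∃ λ m → BCount 𝐮 1 n m × B < m)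
    × ((k : ℕ) → 1 ≤ k → BPrec 𝐮 k (suc k))
theorem6p4 = nth-u , abelian-unbounded , strict-growth
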